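{- Let $a,b\ge 1$ and $n\ge 2$ be integers. The vertex set of the Horadam cube $\Pi^{a,b}_n$ is the disjoint union of the $a$ sets $k\mathcal S^{a,b}_{n-1}=\{k\alpha:\alpha\in\mathcal S^{a,b}_{n-1}\}$, $0\le k\le a-1$, and the $b$ sets $0l\,\mathcal S^{a,b}_{n-2}=\{0l\beta:\beta\in\mathcal S^{a,b}_{n-2}\}$, $a\le l\le a+b-1$. Each of the first $a$ sets induces a subgraph of $\Pi^{a,b}_n$ isomorphic to $\Pi^{a,b}_{n-1}$, and each of the last $b$ sets induces a subgraph isomorphic to $\Pi^{a,b}_{n-2}$. Moreover, the subgraph of $\Pi^{a,b}_n$ induced by $\bigcup_{k=0}^{a-1}k\mathcal S^{a,b}_{n-1}$ is isomorphic to $P_a\square\Pi^{a,b}_{n-1}$, and the subgraph induced by $\bigcup_{l=a}^{a+b-1}0l\,\mathcal S^{a,b}_{n-2}$ is isomorphic to $P_b\square\Pi^{a,b}_{n-2}$. (In the notation $G=H_1\oplus\cdots\oplus H_m$ for such a partition of the vertex set of $G$ into parts inducing $H_1,\dots,H_m$: $\Pi^{a,b}_n=\Pi^{a,b}_{n-1}\oplus\cdots\oplus\Pi^{a,b}_{n-1}\oplus\Pi^{a,b}_{n-2}\oplus\cdots\oplus\Pi^{a,b}_{n-2}=P_a\square\Pi^{a,b}_{n-1}\oplus P_b\square\Pi^{a,b}_{n-2}$, with $a$ copies of $\Pi^{a,b}_{n-1}$ and $b$ copies of $\Pi^{a,b}_{n-2}$.)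
   Context: For integers $a,b\ge1$ and $n\ge 0$, $\mathcal S^{a,b}_n$ is the set of all strings of length $n$ over the alphabet $\{0,1,\dots,a+b-1\}$ in which every letter from $\{a,a+1,\dots,a+b-1\}$ appears only immediately after a letter $0$ (other letters appear arbitrarily); $\mathcal S^{a,b}_0$ contains only the empty string. The Horadam cube $\Pi^{a,b}_n$ is the simple graph with vertex set $\mathcal S^{a,b}_n$ in which $x_1\cdots x_n$ and $y_1\cdots y_n$ are adjacent if and only if $\sum_{i=1}^n|x_i-y_i|=1$. $P_m$ denotes the path graph with $m$ vertices. $G\square H$ denotes the Cartesian product of graphs: vertex set $V(G)\times V(H)$, with $(u_1,v_1)$ and $(u_2,v_2)$ adjacent if $u_1=u_2$ and $v_1v_2\in E(H)$, or $v_1=v_2$ and $u_1u_2\in E(G)$. Juxtaposition of strings denotes concatenation. -}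

module Defs where

open import Data.Fin.Base using (Fin; zero; toℕ; _↑ˡ_; _↑ʳ_)
open import Data.Nat.Base using (ℕ; suc; _+_; _≤_; ∣_-_∣; NonZero)
open import Data.Nat.Properties using (∣-∣-comm; ∣n-n∣≡0; 1+n≢n)
open import Data.Product.Base using (Σ; ∃; ∃-syntax; _×_; _,_; proj₁; proj₂)
open import Data.Product.Relation.Binary.Pointwise.NonDependent using (_×ₛ_)
open import Data.Sum.Base using (_⊎_; inj₁; inj₂; swap)
open import Data.Vec.Base using (Vec; []; _∷_; lookup; sum; zipWith)
open import Function.Base using (_on_)
open import Function.Bundles using (Inverse; _⇔_)
open import Level using (0ℓ) renaming (suc to lsuc)
open import Relation.Binary.Bundles using (Setoid)
open import Relation.Binary.Core using (Rel)
open import Relation.Binary.Definitions using (Symmetric; Irreflexive; _Respects₂_)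
import Relation.Binary.Construct.On as On
open import Relation.Binary.PropositionalEquality
  using (_≡_; _≢_; refl; sym; trans; cong₂; setoid)
open import Relation.Unary using (Pred; _∈_; _≐_; _⊥_; ⋃)

------------------------------------------------------------------------
-- Simple graphs

-- Vertices form a setoid so that a subset of vertices, given by a predicate,
-- can carry the equality of the underlying vertices, ignoring the membership
-- proofs.

record Graph : Set (lsuc 0ℓ) where
  field
    vertices : Setoid 0ℓ 0ℓ
  open Setoid vertices public using (_≈_) renaming (Carrier to V)
  field
    Adj    : Rel V 0ℓ
    resp   : Adj Respects₂ _≈_
    symm   : Symmetric Adj
    irrefl : Irreflexive _≈_ Adj

infix 4 _≅_

record _≅_ (G H : Graph) : Set where
  private
    module G = Graph G
    module H = Graph H
  field
    inverse : Inverse G.vertices H.vertices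
  open Inverse inverse public using (to; from)
  field
    adj : ∀ {u v} → G.Adj u v ⇔ H.Adj (to u) (to v)

induced : (G : Graph) → Pred (Graph.V G) 0ℓ → Graph
induced G P = record
  { vertices = On.setoid {B = Σ V P} vertices proj₁
  ; Adj      = Adj on proj₁
  ; resp     = (λ eq → proj₁ resp eq) , (λ eq → proj₂ resp eq)
  ; symm     = symm
  ; irrefl   = irrefl
  } where open Graph G

path : ℕ → Graph
path m = record
  { vertices = setoid (Fin m)
  ; Adj      = λ i j → toℕ j ≡ suc (toℕ i) ⊎ toℕ i ≡ suc (toℕ j)
  ; resp     = (λ { refl e → e }) , (λ { refl e → e })
  ; symm     = swap
  ; irrefl   = λ { refl (inj₁ e) → 1+n≢n (sym e)
                 ; refl (inj₂ e) → 1+n≢n (sym e) }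
  }

infixr 6 _□_

_□_ : Graph → Graph → Graph
G □ H = record
  { vertices = G.vertices ×ₛ H.vertices
  ; Adj      = λ (u₁ , v₁) (u₂ , v₂) →
                 (u₁ G.≈ u₂ × H.Adj v₁ v₂) ⊎ (v₁ H.≈ v₂ × G.Adj u₁ u₂)
  ; resp     =
      (λ { (p , q) (inj₁ (e , s)) → inj₁ (GS.trans e p , proj₁ H.resp q s)
         ; (p , q) (inj₂ (e , s)) → inj₂ (HS.trans e q , proj₁ G.resp p s) })
    , (λ { (p , q) (inj₁ (e , s)) →
             inj₁ (GS.trans (GS.sym p) e , proj₂ H.resp q s)
         ; (p , q) (inj₂ (e , s)) →
             inj₂ (HS.trans (HS.sym q) e , proj₂ G.resp p s) })
  ; symm     = λ { (inj₁ (e , s)) → inj₁ (GS.sym e , H.symm s)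
                 ; (inj₂ (e , s)) → inj₂ (HS.sym e , G.symm s) }
  ; irrefl   = λ { (p , q) (inj₁ (_ , s)) → H.irrefl q s
                 ; (p , q) (inj₂ (_ , s)) → G.irrefl p s }
  }
  where
  module G = Graph G
  module H = Graph H
  module GS = Setoid G.vertices
  module HS = Setoid H.vertices

------------------------------------------------------------------------
-- Horadam strings and cubes

String : ℕ → ℕ → ℕ → Set
String a b n = Vec (Fin (a + b)) n

𝒮 : ∀ a b n → Pred (String a b n) 0ℓ
𝒮 a b n x = ∀ i → a ≤ toℕ (lookup x i) →
  ∃[ j ] (toℕ i ≡ suc (toℕ j) × toℕ (lookup x j) ≡ 0)

dist : ∀ {m n} → Vec (Fin m) n → Vec (Fin m) n → ℕ
dist x y = sum (zipWith (λ p q → ∣ toℕ p - toℕ q ∣) x y)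

dist-comm : ∀ {m n} (x y : Vec (Fin m) n) → dist x y ≡ dist y x
dist-comm []      []      = refl
dist-comm (p ∷ x) (q ∷ y) =
  cong₂ _+_ (∣-∣-comm (toℕ p) (toℕ q)) (dist-comm x y)

dist-refl : ∀ {m n} (x : Vec (Fin m) n) → dist x x ≡ 0
dist-refl []      = refl
dist-refl (p ∷ x) = cong₂ _+_ (∣n-n∣≡0 (toℕ p)) (dist-refl x)

Π : ℕ → ℕ → ℕ → Graph
Π a b n = record
  { vertices = On.setoid {B = ∃ (𝒮 a b n)} (setoid (String a b n)) proj₁
  ; Adj      = λ (x , _) (y , _) → dist x y ≡ 1
  ; resp     = (λ { refl e → e }) , (λ { refl e → e })
  ; symm     = λ {(x , _)} {(y , _)} e → trans (dist-comm y x) e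
  ; irrefl   = λ { {x , _} refl e → 0≢1 (trans (sym (dist-refl x)) e) }
  }
  where
  0≢1 : 0 ≢ 1
  0≢1 ()

-- The letter 0 of the alphabet Fin (a + b).
0ᴸ : ∀ a b .{{_ : NonZero a}} → Fin (a + b)
0ᴸ (suc a) b = zero

-- The set k𝒮ₙ₊₁, the letter k < a being k ↑ˡ b in the alphabet Fin (a + b).
short : ∀ a b n → Fin a → Pred (String a b (2 + n)) 0ℓ
short a b n k x = ∃[ α ] (α ∈ 𝒮 a b (1 + n) × x ≡ (k ↑ˡ b) ∷ α)

-- The set 0l𝒮ₙ, the letter l = a, …, a + b - 1 being given as its offset from a.
long : ∀ a b n .{{_ : NonZero a}} → Fin b → Pred (String a b (2 + n)) 0ℓ
long a b n l x = ∃[ β ] (β ∈ 𝒮 a b n × x ≡ 0ᴸ a b ∷ (a ↑ʳ l) ∷ β)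

IsDisjointUnion : {A I : Set} → Pred A 0ℓ → (I → Pred A 0ℓ) → Set
IsDisjointUnion {I = I} P Q =
  (P ≐ ⋃ I Q) × (∀ i j → i ≢ j → Q i ⊥ Q j)

{-# OPTIONS --safe #-}
-- The first letter of a Horadam string is always below a. If the second letter
-- is below a as well, deleting the first letter leaves a Horadam string;
-- otherwise the first letter is 0, and deleting both leaves a Horadam string,
-- since the second letter, being ≥ a ≥ 1, cannot license the third. Both k ↦ kα
-- and l ↦ 0lβ shift distances by the distance of the parameters, and naturals
-- adding up to 1 are 0 and 1: this is the adjacency of a Cartesian product with
-- a path.
module Submission where

open import Defs
open import Data.Fin.Base using (Fin; zero; suc; toℕ; splitAt; _↑ˡ_; _↑ʳ_)
open import Data.Fin.Properties
  using (toℕ<n; toℕ-injective; toℕ-↑ˡ; toℕ-↑ʳ; splitAt⁻¹-↑ˡ; splitAt⁻¹-↑ʳ)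
open import Data.Nat.Base
  using (ℕ; zero; suc; _+_; _≤_; _<_; ∣_-_∣; NonZero; >-nonZero⁻¹)
open import Data.Nat.Properties
  using (<⇒≱; m≤m+n; m+n≡0⇒m≡0; m+n≡0⇒n≡0; suc-injective;
         ∣m-n∣≡0⇒m≡n; ∣n-n∣≡0; ∣m+n-m+o∣≡∣n-o∣)
open import Data.Product.Base using (∃-syntax; _×_; _,_; proj₁; proj₂)
open import Data.Sum.Base using (_⊎_; inj₁; inj₂; [_,_])
open import Data.Vec.Base using (Vec; []; _∷_)
open import Data.Vec.Properties using (∷-injectiveʳ)
open import Function.Base using (_∘_)
open import Function.Bundles using (mk⇔)
open import Relation.Binary.PropositionalEquality
  using (_≡_; _≢_; refl; sym; trans; cong; cong₂; subst; module ≡-Reasoning)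
open import Relation.Nullary.Negation using (contradiction)
open import Relation.Unary using (Pred; _∈_; _⊆_; _≐_; _⊥_; _∪_; ⋃; _⊢_)

m+n≡1⇒m≡0×n≡1⊎m≡1×n≡0 : ∀ m {n} → m + n ≡ 1 → (m ≡ 0 × n ≡ 1) ⊎ (m ≡ 1 × n ≡ 0)
m+n≡1⇒m≡0×n≡1⊎m≡1×n≡0 zero          eq = inj₁ (refl , eq)
m+n≡1⇒m≡0×n≡1⊎m≡1×n≡0 (suc zero)    eq = inj₂ (refl , suc-injective eq)
m+n≡1⇒m≡0×n≡1⊎m≡1×n≡0 (suc (suc _)) ()

-- At `m = toℕ i` and `n = toℕ j` the conclusion is, disjunct by disjunct, the adjacency of `i` and
-- `j` in `path`.
∣m-n∣≡1⇒n≡1+m⊎m≡1+n : ∀ m n → ∣ m - n ∣ ≡ 1 → n ≡ suc m ⊎ m ≡ suc n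
∣m-n∣≡1⇒n≡1+m⊎m≡1+n zero    n       eq = inj₁ eq
∣m-n∣≡1⇒n≡1+m⊎m≡1+n (suc m) zero    eq = inj₂ eq
∣m-n∣≡1⇒n≡1+m⊎m≡1+n (suc m) (suc n) eq with ∣m-n∣≡1⇒n≡1+m⊎m≡1+n m n eq
... | inj₁ p = inj₁ (cong suc p)
... | inj₂ p = inj₂ (cong suc p)

∣n-1+n∣≡1 : ∀ n → ∣ n - suc n ∣ ≡ 1
∣n-1+n∣≡1 zero    = refl
∣n-1+n∣≡1 (suc n) = ∣n-1+n∣≡1 n

∣1+n-n∣≡1 : ∀ n → ∣ suc n - n ∣ ≡ 1
∣1+n-n∣≡1 zero    = refl
∣1+n-n∣≡1 (suc n) = ∣1+n-n∣≡1 n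

Adj⇒∣-∣≡1 : ∀ {p} {i j : Fin p} → Graph.Adj (path p) i j → ∣ toℕ i - toℕ j ∣ ≡ 1
Adj⇒∣-∣≡1 {i = i}         (inj₁ eq) rewrite eq = ∣n-1+n∣≡1 (toℕ i)
Adj⇒∣-∣≡1 {i = i} {j = j} (inj₂ eq) rewrite eq = ∣1+n-n∣≡1 (toℕ j)

∣toℕ-toℕ∣≡0⇒≡ : ∀ {p} {i j : Fin p} → ∣ toℕ i - toℕ j ∣ ≡ 0 → i ≡ j
∣toℕ-toℕ∣≡0⇒≡ = toℕ-injective ∘ ∣m-n∣≡0⇒m≡n

dist≡0⇒≡ : ∀ {m n} (x y : Vec (Fin m) n) → dist x y ≡ 0 → x ≡ y
dist≡0⇒≡ []      []      _  = refl
dist≡0⇒≡ (c ∷ x) (d ∷ y) eq = cong₂ _∷_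
  (∣toℕ-toℕ∣≡0⇒≡ (m+n≡0⇒m≡0 ∣ toℕ c - toℕ d ∣ eq))
  (dist≡0⇒≡ x y (m+n≡0⇒n≡0 ∣ toℕ c - toℕ d ∣ eq))

-- Serves both families of parts: `layer` unfolds to `short a b n` in one instance and to
-- `long a b n` in the other. Injectivity and the adjacency claims all rest on `dist-e`.
module Layers {a b m n p} (e : Fin p → String a b m → String a b n)
  (e-𝒮 : ∀ k {α} → α ∈ 𝒮 a b m → e k α ∈ 𝒮 a b n)
  (dist-e : ∀ k l α β → dist (e k α) (e l β) ≡ ∣ toℕ k - toℕ l ∣ + dist α β)
  where

  layer : Fin p → Pred (String a b n) _
  layer k x = ∃[ α ] (α ∈ 𝒮 a b m × x ≡ e k α)

  layer⊆𝒮 : ∀ k {x} → x ∈ layer k → x ∈ 𝒮 a b n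
  layer⊆𝒮 k (_ , α∈𝒮 , refl) = e-𝒮 k α∈𝒮

  -- Equal images are at distance 0, so both summands in `dist-e` vanish, and a vanishing distance
  -- forces equality in each coordinate.
  e-injective : ∀ {k l α β} → e k α ≡ e l β → k ≡ l × α ≡ β
  e-injective {k} {l} {α} {β} eq =
      ∣toℕ-toℕ∣≡0⇒≡ (m+n≡0⇒m≡0 ∣ toℕ k - toℕ l ∣ sum≡0)
    , dist≡0⇒≡ α β (m+n≡0⇒n≡0 ∣ toℕ k - toℕ l ∣ sum≡0)
    where
    sum≡0 : ∣ toℕ k - toℕ l ∣ + dist α β ≡ 0
    sum≡0 = begin
      ∣ toℕ k - toℕ l ∣ + dist α β  ≡⟨ dist-e k l α β ⟨
      dist (e k α) (e l β)          ≡⟨ cong (dist (e k α)) eq ⟨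
      dist (e k α) (e k α)          ≡⟨ dist-refl (e k α) ⟩
      0                             ∎
      where open ≡-Reasoning

  layers-unique : ∀ {k l x} → x ∈ layer k → x ∈ layer l → k ≡ l
  layers-unique (_ , _ , eq) (_ , _ , eq′) = proj₁ (e-injective (trans (sym eq) eq′))

  dist-layer : ∀ k α β → dist (e k α) (e k β) ≡ dist α β
  dist-layer k α β = trans (dist-e k k α β) (cong (_+ dist α β) (∣n-n∣≡0 (toℕ k)))

  layer≅ : ∀ k → induced (Π a b n) (proj₁ ⊢ layer k) ≅ Π a b m
  layer≅ k = record
    { inverse = record
      { to        = λ (_ , α , α∈𝒮 , _) → α , α∈𝒮
      ; from      = λ (α , α∈𝒮) → (e k α , e-𝒮 k α∈𝒮) , α , α∈𝒮 , refl
      -- Vertices are compared by their strings alone; matching the membership proofs with `refl`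
      -- turns `eq` into an equation between values of `e k`.
      ; to-cong   = λ { {_ , _ , _ , refl} {_ , _ , _ , refl} eq → proj₂ (e-injective eq) }
      ; from-cong = cong (e k)
      ; inverse   = (λ { {_} {_ , _ , _ , refl} eq → proj₂ (e-injective eq) })
                  , (λ { {_ , _ , _ , refl} refl → refl })
      }
    ; adj = λ { {_ , α , _ , refl} {_ , β , _ , refl} →
        mk⇔ (trans (sym (dist-layer k α β))) (trans (dist-layer k α β)) }
    }

  ⋃layer≅ : induced (Π a b n) (proj₁ ⊢ ⋃ (Fin p) layer) ≅ path p □ Π a b m
  ⋃layer≅ = record
    { inverse = record
      { to        = λ (_ , k , α , α∈𝒮 , _) → k , α , α∈𝒮
      ; from      = λ (k , α , α∈𝒮) → (e k α , e-𝒮 k α∈𝒮) , k , α , α∈𝒮 , refl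
      ; to-cong   = λ { {_ , _ , _ , _ , refl} {_ , _ , _ , _ , refl} → e-injective }
      ; from-cong = λ (k≡l , α≡β) → cong₂ e k≡l α≡β
      ; inverse   = (λ { {_} {_ , _ , _ , _ , refl} → e-injective })
                  , (λ { {_ , _ , _ , _ , refl} (refl , refl) → refl })
      }
    ; adj = λ { {_ , k , α , _ , refl} {_ , l , β , _ , refl} → mk⇔
        (λ eq → [ (λ (p , q) → inj₁ (∣toℕ-toℕ∣≡0⇒≡ p , q))
                , (λ (p , q) → inj₂ (dist≡0⇒≡ α β q , ∣m-n∣≡1⇒n≡1+m⊎m≡1+n _ _ p)) ]
                (m+n≡1⇒m≡0×n≡1⊎m≡1×n≡0 _ (trans (sym (dist-e k l α β)) eq)))
        (λ { (inj₁ (refl , q)) → trans (dist-layer k α β) q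
           ; (inj₂ (refl , q)) →
               trans (dist-e k l α α) (cong₂ _+_ (Adj⇒∣-∣≡1 {i = k} q) (dist-refl α)) }) }
    }

toℕ-0ᴸ : ∀ a b .{{_ : NonZero a}} → toℕ (0ᴸ a b) ≡ 0
toℕ-0ᴸ (suc a) b = refl

0ᴸ<a : ∀ a b .{{_ : NonZero a}} → toℕ (0ᴸ a b) < a
0ᴸ<a a b = subst (_< a) (sym (toℕ-0ᴸ a b)) (>-nonZero⁻¹ a)

toℕ≡0⇒≡0ᴸ : ∀ a b .{{_ : NonZero a}} {c} → toℕ c ≡ 0 → c ≡ 0ᴸ a b
toℕ≡0⇒≡0ᴸ a b eq = toℕ-injective (trans eq (sym (toℕ-0ᴸ a b)))

toℕ-↑ˡ<a : ∀ {a} b (k : Fin a) → toℕ (k ↑ˡ b) < a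
toℕ-↑ˡ<a {a} b k = subst (_< a) (sym (toℕ-↑ˡ k b)) (toℕ<n k)

a≤toℕ-↑ʳ : ∀ a {b} (l : Fin b) → a ≤ toℕ (a ↑ʳ l)
a≤toℕ-↑ʳ a l = subst (a ≤_) (sym (toℕ-↑ʳ a l)) (m≤m+n a (toℕ l))

-- The equations are oriented so that matching on `refl` replaces `c` by its form in either block of
-- the alphabet.
letter : ∀ {a b} (c : Fin (a + b)) → (∃[ k ] k ↑ˡ b ≡ c) ⊎ (∃[ l ] a ↑ʳ l ≡ c)
letter {a} c with splitAt a c in eq
... | inj₁ k = inj₁ (k , splitAt⁻¹-↑ˡ eq)
... | inj₂ l = inj₂ (l , splitAt⁻¹-↑ʳ eq)

module _ {a b : ℕ} where

  -- Nothing precedes position `zero`, so a letter from `a` upwards has no licence there.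
  𝒮-head : ∀ {n c x} → (c ∷ x) ∈ 𝒮 a b (suc n) → toℕ c < a
  𝒮-head {c = c} cx∈𝒮 with letter {a} c
  ... | inj₁ (k , refl) = toℕ-↑ˡ<a b k
  ... | inj₂ (l , refl) with () ← proj₁ (proj₂ (cx∈𝒮 zero (a≤toℕ-↑ʳ a l)))

  𝒮-cons : ∀ {n c x} → toℕ c < a → x ∈ 𝒮 a b n → (c ∷ x) ∈ 𝒮 a b (suc n)
  𝒮-cons c<a x∈𝒮 zero    a≤c = contradiction a≤c (<⇒≱ c<a)
  𝒮-cons c<a x∈𝒮 (suc i) a≤x with x∈𝒮 i a≤x
  ... | j , eq , xⱼ≡0 = suc j , cong suc eq , xⱼ≡0

  𝒮-tail : ∀ {n c d x} → toℕ d < a →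
    (c ∷ d ∷ x) ∈ 𝒮 a b (2 + n) → (d ∷ x) ∈ 𝒮 a b (1 + n)
  𝒮-tail d<a cdx∈𝒮 zero    a≤d = contradiction a≤d (<⇒≱ d<a)
  𝒮-tail d<a cdx∈𝒮 (suc i) a≤x with cdx∈𝒮 (suc (suc i)) a≤x
  -- The licence for position `2 + i` sits at `1 + i`, hence never at the deleted first letter.
  ... | suc j , eq , xⱼ≡0 = j , suc-injective eq , xⱼ≡0

  -- The letter `c` licenses `d`, whatever `d` is. Since `a` may be 0 here, `c<a` does not follow
  -- from `c≡0`.
  𝒮-0-cons : ∀ {n c d x} → toℕ c ≡ 0 → toℕ c < a →
    x ∈ 𝒮 a b n → (c ∷ d ∷ x) ∈ 𝒮 a b (2 + n)
  𝒮-0-cons c≡0 c<a x∈𝒮 zero          a≤c = contradiction a≤c (<⇒≱ c<a)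
  𝒮-0-cons c≡0 c<a x∈𝒮 (suc zero)    _   = zero , refl , c≡0
  𝒮-0-cons c≡0 c<a x∈𝒮 (suc (suc i)) a≤x with x∈𝒮 i a≤x
  ... | j , eq , xⱼ≡0 = suc (suc j) , cong (2 +_) eq , xⱼ≡0

module _ (a b n : ℕ) .{{_ : NonZero a}} where

  𝒮-drop₂ : ∀ {c d x} → a ≤ toℕ d → (c ∷ d ∷ x) ∈ 𝒮 a b (2 + n) → x ∈ 𝒮 a b n
  𝒮-drop₂ a≤d cdx∈𝒮 i a≤x with cdx∈𝒮 (suc (suc i)) a≤x
  -- Here the licence would be `d` itself, and `toℕ d ≡ 0` would give `a ≤ 0`.
  ... | suc zero    , eq , d≡0  = contradiction (subst (a ≤_) d≡0 a≤d) (<⇒≱ (>-nonZero⁻¹ a))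
  ... | suc (suc j) , eq , xⱼ≡0 = j , suc-injective (suc-injective eq) , xⱼ≡0

  module Short = Layers {a} {b} {1 + n} {2 + n} (λ k α → (k ↑ˡ b) ∷ α)
    (λ k → 𝒮-cons (toℕ-↑ˡ<a b k))
    (λ k l α β → cong (_+ dist α β) (cong₂ ∣_-_∣ (toℕ-↑ˡ k b) (toℕ-↑ˡ l b)))

  -- The shared leading 0 contributes nothing, and the shared offset `a` cancels in the difference.
  dist-long : ∀ (k l : Fin b) (α β : String a b n) →
    dist (0ᴸ a b ∷ (a ↑ʳ k) ∷ α) (0ᴸ a b ∷ (a ↑ʳ l) ∷ β) ≡ ∣ toℕ k - toℕ l ∣ + dist α β
  dist-long k l α β
    rewrite ∣n-n∣≡0 (toℕ (0ᴸ a b)) | toℕ-↑ʳ a k | toℕ-↑ʳ a l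
          | ∣m+n-m+o∣≡∣n-o∣ a (toℕ k) (toℕ l) = refl

  module Long = Layers {a} {b} {n} {2 + n} (λ l β → 0ᴸ a b ∷ (a ↑ʳ l) ∷ β)
    (λ l → 𝒮-0-cons (toℕ-0ᴸ a b) (0ᴸ<a a b)) dist-long

  -- Cancelling the first letter of a common string would make `α` a Horadam string starting with
  -- `a ↑ʳ l`, against `𝒮-head`.
  short⊥long : ∀ k l → short a b n k ⊥ long a b n l
  short⊥long k l ((α , α∈𝒮 , eq) , (β , _ , eq′))
    with refl ← ∷-injectiveʳ (trans (sym eq) eq′) = <⇒≱ (𝒮-head α∈𝒮) (a≤toℕ-↑ʳ a l)

  𝒮⊆short∪long : ∀ {x} → x ∈ 𝒮 a b (2 + n) →
    x ∈ ⋃ (Fin a) (short a b n) ∪ ⋃ (Fin b) (long a b n)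
  𝒮⊆short∪long {c ∷ d ∷ x} cdx∈𝒮 with letter {a} c | letter {a} d
  ... | inj₂ (l , refl) | _ = contradiction (a≤toℕ-↑ʳ a l) (<⇒≱ (𝒮-head cdx∈𝒮))
  ... | inj₁ (k , refl) | inj₁ (k′ , refl) =
    inj₁ (k , _ , 𝒮-tail (toℕ-↑ˡ<a b k′) cdx∈𝒮 , refl)
  ... | inj₁ (k , refl) | inj₂ (l , refl) with cdx∈𝒮 (suc zero) (a≤toℕ-↑ʳ a l)
  -- The second letter can only be licensed from position `zero`, which identifies the first letter
  -- as `0ᴸ a b`.
  ...   | zero , _ , c≡0 =
    inj₂ (l , x , 𝒮-drop₂ (a≤toℕ-↑ʳ a l) cdx∈𝒮 , cong (_∷ _) (toℕ≡0⇒≡0ᴸ a b c≡0))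

theorem1 : (a b n : ℕ) .{{_ : NonZero a}} .{{_ : NonZero b}} →
    let G = Π a b (2 + n)
        X = short a b n
        Y = long a b n
        ⋃X = ⋃ (Fin a) X
        ⋃Y = ⋃ (Fin b) Y
    in IsDisjointUnion (𝒮 a b (2 + n)) [ X , Y ]
     × (∀ k → induced G (proj₁ ⊢ X k) ≅ Π a b (1 + n))
     × (∀ l → induced G (proj₁ ⊢ Y l) ≅ Π a b n)
     × (𝒮 a b (2 + n) ≐ ⋃X ∪ ⋃Y) × (⋃X ⊥ ⋃Y)
     × (induced G (proj₁ ⊢ ⋃X) ≅ path a □ Π a b (1 + n))
     × (induced G (proj₁ ⊢ ⋃Y) ≅ path b □ Π a b n)
theorem1 a b n =
    ((cover , λ { (inj₁ k , p) → S.layer⊆𝒮 k p ; (inj₂ l , p) → L.layer⊆𝒮 l p })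
    , disjoint)
  , S.layer≅
  , L.layer≅
  , (𝒮⊆short∪long a b n
    , [ (λ (k , p) → S.layer⊆𝒮 k p) , (λ (l , p) → L.layer⊆𝒮 l p) ])
  , (λ ((k , p) , (l , q)) → short⊥long a b n k l (p , q))
  , S.⋃layer≅
  , L.⋃layer≅
  where
  module S = Short a b n
  module L = Long a b n

  cover : 𝒮 a b (2 + n) ⊆ ⋃ (Fin a ⊎ Fin b) [ short a b n , long a b n ]
  cover x∈𝒮 with 𝒮⊆short∪long a b n x∈𝒮
  ... | inj₁ (k , p) = inj₁ k , p
  ... | inj₂ (l , p) = inj₂ l , p

  -- Within one family a string determines the index of its layer; across families `short⊥long`
  -- applies.
  disjoint : ∀ i j → i ≢ j → [ short a b n , long a b n ] i ⊥ [ short a b n , long a b n ] j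
  disjoint (inj₁ k) (inj₁ l) k≢l (p , q) = k≢l (cong inj₁ (S.layers-unique p q))
  disjoint (inj₁ k) (inj₂ l) _   (p , q) = short⊥long a b n k l (p , q)
  disjoint (inj₂ l) (inj₁ k) _   (p , q) = short⊥long a b n k l (q , p)
  disjoint (inj₂ k) (inj₂ l) k≢l (p , q) = k≢l (cong inj₂ (L.layers-unique p q))
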